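{- Let $\Phi$ be a finite nonempty set of proposition symbols and let $\mathcal{K} \subseteq \mathcal{KT}(\Phi)$ be a class of $\Phi$-models with teams. Then $\mathcal{K}$ is definable in $\mathrm{MINC}(\Phi)$ if and only if $\mathcal{K}$ is closed under unions, is closed under team $k$-bisimulation for some $k \in \mathbb{N}$, and has the empty team property.
   Context: Kripke models and teams. A Kripke model over a set $\Phi$ of proposition symbols is a triple $K=(W,R,V)$ with $W$ a set, $R\subseteq W\times W$, and $V:\Phi\to\mathcal{P}(W)$. A team of $K$ is any subset $T\subseteq W$. Write $R[T]=\{v\in W\mid \exists w\in T: wRv\}$, and $T[R]S$ if for every $v\in S$ there is $w\in T$ with $wRv$ and for every $w\in T$ there is $v\in S$ with $wRv$. A $\Phi$-model with a team is a pair $(K,T)$ with $K$ a Kripke model over $\Phi$ and $T$ a team of $K$; $\mathcal{KT}(\Phi)$ is the class of all such pairs. Modal logic $\mathrm{ML}(\Phi)$: formulas are generated by $\varphi:= p\mid \neg p\mid(\varphi\land\varphi)\mid(\varphi\lor\varphi)\mid\Diamond\varphi\mid\Box\varphi$, $p\in\Phi$. Team semantics: $K,T\models p$ iff $T\subseteq V(p)$; $K,T\models\neg p$ iff $T\cap V(p)=\emptyset$; $K,T\models\varphi\land\psi$ iff $K,T\models\varphi$ and $K,T\models\psi$; $K,T\models\varphi\lor\psi$ iff there are $T_1,T_2$ with $T_1\cup T_2=T$, $K,T_1\models\varphi$ and $K,T_2\models\psi$; $K,T\models\Diamond\varphi$ iff $K,S\models\varphi$ for some $S$ with $T[R]S$;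 $K,T\models\Box\varphi$ iff $K,R[T]\models\varphi$. For a state $w$, $K,w\models\varphi$ abbreviates $K,\{w\}\models\varphi$. Modal inclusion logic $\mathrm{MINC}(\Phi)$: formulas are generated by the same grammar as $\mathrm{ML}(\Phi)$ extended with inclusion atoms $\varphi_1\ldots\varphi_n\subseteq\psi_1\ldots\psi_n$ ($n\ge 1$), where all $\varphi_i,\psi_i$ are $\mathrm{ML}(\Phi)$-formulas (so inclusion atoms are not nested). The team semantics of $\mathrm{MINC}(\Phi)$ is given, for $p\in\Phi$ and $\mathrm{MINC}(\Phi)$-formulas $\varphi,\psi$, by: $K,T\models p$ iff $T\subseteq V(p)$; $K,T\models\neg p$ iff $T\cap V(p)=\emptyset$; $K,T\models\varphi\land\psi$ iff $K,T\models\varphi$ and $K,T\models\psi$; $K,T\models\varphi\lor\psi$ iff there are $T_1,T_2$ with $T_1\cup T_2=T$, $K,T_1\models\varphi$ and $K,T_2\models\psi$; $K,T\models\Diamond\varphi$ iff $K,S\models\varphi$ for some $S$ with $T[R]S$; $K,T\models\Box\varphi$ iff $K,R[T]\models\varphi$; with the additional clause: $K,T\models\varphi_1\ldots\varphi_n\subseteq\psi_1\ldots\psi_n$ iff for every $w\in T$ there is $v\in T$ such that for all $1\le i\le n$: $K,w\models\varphi_i\iff K,v\models\psi_i$. Bisimulation. $K,w\rightleftarrows_0 K',w'$ iff $K,w\models p\iff K',w'\models p$ for all $p\in\Phi$. $K,w\rightleftarrows_{k+1}K',w'$ iff $K,w\rightleftarrows_0K',w'$, for every $v$ with $wRv$ there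 is $v'$ with $w'R'v'$ and $K,v\rightleftarrows_kK',v'$, and for every $v'$ with $w'R'v'$ there is $v$ with $wRv$ and $K,v\rightleftarrows_kK',v'$. Pairs $(K,T)$ and $(K',T')$ are team $k$-bisimilar, $K,T[\rightleftarrows_k]K',T'$, if for every $w\in T$ there is $w'\in T'$ with $K,w\rightleftarrows_kK',w'$ and for every $w'\in T'$ there is $w\in T$ with $K,w\rightleftarrows_kK',w'$. Closure properties of a class $\mathcal{K}\subseteq\mathcal{KT}(\Phi)$. It is closed under team $k$-bisimulation if $(K,T)\in\mathcal{K}$ and $K,T[\rightleftarrows_k]K',T'$ imply $(K',T')\in\mathcal{K}$. It is closed under unions if, whenever $T_i$, $i\in I$, are teams of a Kripke model $K$ with $(K,T_i)\in\mathcal{K}$ for all $i\in I$, then $(K,\bigcup_{i\in I}T_i)\in\mathcal{K}$. It has the empty team property if $(K,\emptyset)\in\mathcal{K}$ for every Kripke model $K$ over $\Phi$. $\mathcal{K}$ is definable in a logic if there is a formula $\varphi$ of that logic with $\mathcal{K}=\{(K,T)\in\mathcal{KT}(\Phi)\mid K,T\models\varphi\}$. -}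

module Defs where

open import Level using (Level; Lift) renaming (suc to lsuc; _⊔_ to _⊔ˡ_)
open import Data.Fin.Base using (Fin)
open import Data.Nat.Base using (ℕ; zero; suc)
open import Data.Product.Base using (Σ-syntax; ∃-syntax; _×_; _,_)
open import Data.Vec.Base using (Vec; lookup)
open import Function.Bundles using (_⇔_)
open import Relation.Binary.Core using (Rel)
open import Relation.Unary using (Pred; _∈_; _⊆_; _∩_; _∪_; _≐_; Empty; ｛_｝; ⋃)
open import Relation.Unary.Polymorphic using (∅)

private
  variable
    ℓ κ : Level
    Φ : Set

-- Sets are types at a fixed but arbitrary level ℓ, and subsets are predicates
-- at that same level; equality of subsets is extensional equality _≐_.

record Kripke (Φ : Set) (ℓ : Level) : Set (lsuc ℓ) where
  field
    W : Set ℓ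
    R : Rel W ℓ
    V : Φ → Pred W ℓ

open Kripke public

Team : Kripke Φ ℓ → Set (lsuc ℓ)
Team {ℓ = ℓ} K = Pred (W K) ℓ

KT : Set → (ℓ : Level) → Set (lsuc ℓ)
KT Φ ℓ = Σ[ K ∈ Kripke Φ ℓ ] Team K

-- image K T is R[T], and Step K T S is T[R]S.

image : (K : Kripke Φ ℓ) → Team K → Team K
image K T v = ∃[ w ] (w ∈ T × R K w v)

Step : (K : Kripke Φ ℓ) → Team K → Team K → Set ℓ
Step K T S = (∀ v → v ∈ S → ∃[ w ] (w ∈ T × R K w v))
           × (∀ w → w ∈ T → ∃[ v ] (v ∈ S × R K w v))


module ML where

  data Formula (Φ : Set) : Set where
    prop    : Φ → Formula Φ
    negProp : Φ → Formula Φ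
    _∧_     : Formula Φ → Formula Φ → Formula Φ
    _∨_     : Formula Φ → Formula Φ → Formula Φ
    ◇       : Formula Φ → Formula Φ
    □       : Formula Φ → Formula Φ

  -- ∨ and ◇ quantify over teams, so satisfaction lives one level above ℓ;
  -- this is the reason for Lift in the literal clauses.
  Sat : (K : Kripke Φ ℓ) → Team K → Formula Φ → Set (lsuc ℓ)
  Sat {ℓ = ℓ} K T (prop p)    = Lift (lsuc ℓ) (T ⊆ V K p)
  Sat {ℓ = ℓ} K T (negProp p) = Lift (lsuc ℓ) (Empty (T ∩ V K p))
  Sat K T (φ ∧ ψ) = Sat K T φ × Sat K T ψ
  Sat K T (φ ∨ ψ) = Σ[ T₁ ∈ Team K ] Σ[ T₂ ∈ Team K ]
                      ((T₁ ∪ T₂) ≐ T × Sat K T₁ φ × Sat K T₂ ψ)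
  Sat K T (◇ φ)   = Σ[ S ∈ Team K ] (Step K T S × Sat K S φ)
  Sat K T (□ φ)   = Sat K (image K T) φ

  SatAt : (K : Kripke Φ ℓ) → W K → Formula Φ → Set (lsuc ℓ)
  SatAt K w φ = Sat K ｛ w ｝ φ

module MINC where

  data Formula (Φ : Set) : Set where
    prop    : Φ → Formula Φ
    negProp : Φ → Formula Φ
    _∧_     : Formula Φ → Formula Φ → Formula Φ
    _∨_     : Formula Φ → Formula Φ → Formula Φ
    ◇       : Formula Φ → Formula Φ
    □       : Formula Φ → Formula Φ
    incl    : ∀ {n} → (φs ψs : Vec (ML.Formula Φ) (suc n)) → Formula Φ

  Sat : (K : Kripke Φ ℓ) → Team K → Formula Φ → Set (lsuc ℓ)
  Sat {ℓ = ℓ} K T (prop p)    = Lift (lsuc ℓ) (T ⊆ V K p)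
  Sat {ℓ = ℓ} K T (negProp p) = Lift (lsuc ℓ) (Empty (T ∩ V K p))
  Sat K T (φ ∧ ψ) = Sat K T φ × Sat K T ψ
  Sat K T (φ ∨ ψ) = Σ[ T₁ ∈ Team K ] Σ[ T₂ ∈ Team K ]
                      ((T₁ ∪ T₂) ≐ T × Sat K T₁ φ × Sat K T₂ ψ)
  Sat K T (◇ φ)   = Σ[ S ∈ Team K ] (Step K T S × Sat K S φ)
  Sat K T (□ φ)   = Sat K (image K T) φ
  Sat K T (incl {n} φs ψs) =
    ∀ w → w ∈ T → ∃[ v ] (v ∈ T ×
      (∀ (i : Fin (suc n)) →
         ML.SatAt K w (lookup φs i) ⇔ ML.SatAt K v (lookup ψs i)))

Bisim : ℕ → (K : Kripke Φ ℓ) → W K → (K′ : Kripke Φ ℓ) → W K′ → Set ℓ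
Bisim zero    K w K′ w′ = ∀ p → (w ∈ V K p) ⇔ (w′ ∈ V K′ p)
Bisim (suc k) K w K′ w′ =
    Bisim zero K w K′ w′
  × (∀ v  → R K  w  v  → ∃[ v′ ] (R K′ w′ v′ × Bisim k K v K′ v′))
  × (∀ v′ → R K′ w′ v′ → ∃[ v  ] (R K  w  v  × Bisim k K v K′ v′))

TeamBisim : ℕ → KT Φ ℓ → KT Φ ℓ → Set ℓ
TeamBisim k (K , T) (K′ , T′) =
    (∀ w  → w  ∈ T  → ∃[ w′ ] (w′ ∈ T′ × Bisim k K w K′ w′))
  × (∀ w′ → w′ ∈ T′ → ∃[ w  ] (w  ∈ T  × Bisim k K w K′ w′))

ClosedUnderTeamBisim : ℕ → Pred (KT Φ ℓ) κ → Set (lsuc ℓ ⊔ˡ κ)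
ClosedUnderTeamBisim k 𝒦 = ∀ KT₁ KT₂ → KT₁ ∈ 𝒦 → TeamBisim k KT₁ KT₂ → KT₂ ∈ 𝒦

ClosedUnderUnions : Pred (KT Φ ℓ) κ → Set (lsuc ℓ ⊔ˡ κ)
ClosedUnderUnions {Φ = Φ} {ℓ = ℓ} 𝒦 =
  ∀ (K : Kripke Φ ℓ) (I : Set ℓ) (T : I → Team K) →
    (∀ i → (K , T i) ∈ 𝒦) → (K , ⋃ I T) ∈ 𝒦

EmptyTeamProperty : Pred (KT Φ ℓ) κ → Set (lsuc ℓ ⊔ˡ κ)
EmptyTeamProperty {Φ = Φ} {ℓ = ℓ} 𝒦 = ∀ (K : Kripke Φ ℓ) → (K , ∅) ∈ 𝒦

DefinableInMINC : Pred (KT Φ ℓ) κ → Set (lsuc ℓ ⊔ˡ κ)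
DefinableInMINC {Φ = Φ} 𝒦 =
  Σ[ φ ∈ MINC.Formula Φ ] 𝒦 ≐ (λ (K , T) → MINC.Sat K T φ)

{-# OPTIONS --safe #-}
-- Evaluating ML-formulas pointwise is sound because ML is flat.  Over a finite Φ, finitely
-- many Hintikka formulas of depth k describe points up to k-bisimilarity.  A nonempty team is
-- then described up to team k-bisimilarity by stating, for each Hintikka formula χ, either
-- ⊤ ⊆ χ (some point satisfies χ, unless the team is empty) or ∼ χ at every point.  The
-- class 𝒦 is defined by the disjunction of those descriptions that hold in some nonempty
-- team of 𝒦: a team satisfying it is a union of teams that are empty or k-bisimilar to
-- members of 𝒦.
module Submission where

open import Defs
open import Axiom.ExcludedMiddle using (ExcludedMiddle)
open import Level using (Level; _⊔_; Lift; lift; lower) renaming (suc to lsuc)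
open import Data.Bool.Base using (Bool; true; false; if_then_else_)
open import Data.Empty using (⊥; ⊥-elim)
open import Data.Fin.Base as Fin using (Fin)
open import Data.List.Base as List using (List; []; _∷_; _++_; allFin; cartesianProductWith; filter; foldr)
open import Data.List.Membership.Propositional using (_∈_)
open import Data.List.Membership.Propositional.Properties
  using (∈-cartesianProductWith⁺; ∈-cartesianProductWith⁻; ∈-map⁺; ∈-map⁻; ∈-++⁺ˡ; ∈-++⁺ʳ; ∈-allFin; ∈-filter⁺; ∈-filter⁻)
open import Data.List.Relation.Unary.Any using (here; there)
open import Data.Nat.Base as ℕ using (ℕ; zero; suc; _≤_; s≤s)
open import Data.Nat.Properties using (≤-refl; ≤-trans; m≤m⊔n; m≤n⊔m; m⊔n≤o⇒m≤o; m⊔n≤o⇒n≤o)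
open import Data.Product.Base as Product using (_×_; _,_; proj₁; proj₂; ∃-syntax; Σ-syntax; uncurry)
open import Data.Sum.Base using (_⊎_; inj₁; inj₂; [_,_]′)
open import Data.Vec.Base as Vec using (Vec; []; _∷_; lookup)
open import Function.Base using (_∘_; id)
open import Function.Bundles using (_⇔_; _↔_; mk⇔; Equivalence; Inverse)
open import Function.Properties.Equivalence using () renaming (sym to ⇔-sym; trans to ⇔-trans)
open import Relation.Binary.PropositionalEquality using (refl; subst)
open import Relation.Nullary using (¬_; yes; no; contradiction)
open import Relation.Nullary.Decidable using (map′)
open import Relation.Unary using (Pred; _≐_; _∪_; ⋃)
open import Relation.Unary.Polymorphic using (∅)

open Equivalence using (to; from)

private
  variable
    a ℓ κ : Level
    Φ : Set

-- Bisimilarity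

Bisim-zero : ∀ k {K K′ : Kripke Φ ℓ} {w w′} → Bisim k K w K′ w′ → Bisim zero K w K′ w′
Bisim-zero zero    b = b
Bisim-zero (suc k) b = proj₁ b

Bisim-refl : ∀ k (K : Kripke Φ ℓ) w → Bisim k K w K w
Bisim-refl zero    K w p = mk⇔ id id
Bisim-refl (suc k) K w =
    (λ p → mk⇔ id id)
  , (λ v wRv → v , wRv , Bisim-refl k K v)
  , (λ v wRv → v , wRv , Bisim-refl k K v)

Bisim-sym : ∀ k {K K′ : Kripke Φ ℓ} {w w′} → Bisim k K w K′ w′ → Bisim k K′ w′ K w
Bisim-sym zero    b p = ⇔-sym (b p)
Bisim-sym (suc k) (b , forth , back) =
    (λ p → ⇔-sym (b p))
  , (λ v′ w′Rv′ → Product.map₂ (Product.map₂ (Bisim-sym k)) (back v′ w′Rv′))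
  , (λ v wRv → Product.map₂ (Product.map₂ (Bisim-sym k)) (forth v wRv))

TeamBisim-≐ : ∀ k (K : Kripke Φ ℓ) {T T′ : Team K} → T ≐ T′ → TeamBisim k (K , T) (K , T′)
TeamBisim-≐ k K (T⊆T′ , T′⊆T) =
    (λ w w∈T  → w , T⊆T′ w∈T  , Bisim-refl k K w)
  , (λ w w∈T′ → w , T′⊆T w∈T′ , Bisim-refl k K w)

-- Pointwise semantics of ML

infix 4 _,_⊩_

-- No team is quantified over, so this lives at level ℓ, one below `ML.Sat`, and can itself be used
-- to carve out teams.
_,_⊩_ : (K : Kripke Φ ℓ) → W K → ML.Formula Φ → Set ℓ
K , w ⊩ ML.prop p    = V K p w
K , w ⊩ ML.negProp p = ¬ V K p w
K , w ⊩ (φ ML.∧ ψ)   = (K , w ⊩ φ) × (K , w ⊩ ψ)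
K , w ⊩ (φ ML.∨ ψ)   = (K , w ⊩ φ) ⊎ (K , w ⊩ ψ)
K , w ⊩ ML.◇ φ       = ∃[ v ] (R K w v × (K , v ⊩ φ))
K , w ⊩ ML.□ φ       = ∀ v → R K w v → K , v ⊩ φ

flat⁻ : ∀ {K : Kripke Φ ℓ} φ {T} → ML.Sat K T φ → ∀ w → T w → K , w ⊩ φ
flat⁻ (ML.prop p)    (lift T⊆V)        w w∈T = T⊆V w∈T
flat⁻ (ML.negProp p) (lift T∩V=∅)      w w∈T w∈V = T∩V=∅ w (w∈T , w∈V)
flat⁻ (φ ML.∧ ψ)     (s , t)           w w∈T = flat⁻ φ s w w∈T , flat⁻ ψ t w w∈T
flat⁻ (φ ML.∨ ψ)     (_ , _ , (_ , T⊆) , s , t) w w∈T with T⊆ w∈T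
... | inj₁ w∈T₁ = inj₁ (flat⁻ φ s w w∈T₁)
... | inj₂ w∈T₂ = inj₂ (flat⁻ ψ t w w∈T₂)
flat⁻ (ML.◇ φ)       (S , (_ , forth) , s) w w∈T with forth w w∈T
... | v , v∈S , wRv = v , wRv , flat⁻ φ s v v∈S
flat⁻ (ML.□ φ)       s                 w w∈T v wRv = flat⁻ φ s v (w , w∈T , wRv)

-- The witness teams for `∨` and `◇` are the largest candidates: all points of `T` satisfying the
-- disjunct, all successors of `T` satisfying `φ`. Hence no selection has to be made.
flat⁺ : ∀ {K : Kripke Φ ℓ} φ {T} → (∀ w → T w → K , w ⊩ φ) → ML.Sat K T φ
flat⁺ (ML.prop p)    f = lift (λ {w} → f w)
flat⁺ (ML.negProp p) f = lift (λ w → uncurry (f w))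
flat⁺ (φ ML.∧ ψ)     f = flat⁺ φ (λ w → proj₁ ∘ f w) , flat⁺ ψ (λ w → proj₂ ∘ f w)
flat⁺ {K = K} (φ ML.∨ ψ) {T} f =
    (λ w → T w × (K , w ⊩ φ)) , (λ w → T w × (K , w ⊩ ψ))
  , ([ proj₁ , proj₁ ]′ , λ {w} w∈T → [ (λ s → inj₁ (w∈T , s)) , (λ s → inj₂ (w∈T , s)) ]′ (f w w∈T))
  , flat⁺ φ (λ _ → proj₂) , flat⁺ ψ (λ _ → proj₂)
flat⁺ {K = K} (ML.◇ φ) {T} f =
    (λ v → (∃[ w ] (T w × R K w v)) × (K , v ⊩ φ))
  , ( (λ _ → proj₁)
    , (λ w w∈T → let v , wRv , s = f w w∈T in v , ((w , w∈T , wRv) , s) , wRv))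
  , flat⁺ φ (λ _ → proj₂)
flat⁺ (ML.□ φ)       f = flat⁺ φ (λ v (w , w∈T , wRv) → f w w∈T v wRv)

SatAt⇔⊩ : ∀ {K : Kripke Φ ℓ} {w} φ → ML.SatAt K w φ ⇔ (K , w ⊩ φ)
SatAt⇔⊩ {w = w} φ = mk⇔ (λ s → flat⁻ φ s w refl) (λ s → flat⁺ φ λ { _ refl → s })

-- Invariance under bisimulation

depthML : ML.Formula Φ → ℕ
depthML (ML.prop p)    = 0
depthML (ML.negProp p) = 0
depthML (φ ML.∧ ψ)     = depthML φ ℕ.⊔ depthML ψ
depthML (φ ML.∨ ψ)     = depthML φ ℕ.⊔ depthML ψ
depthML (ML.◇ φ)       = suc (depthML φ)
depthML (ML.□ φ)       = suc (depthML φ)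

⊩-bisim : ∀ {k} {K K′ : Kripke Φ ℓ} {w w′} φ → depthML φ ≤ k →
          Bisim k K w K′ w′ → K , w ⊩ φ → K′ , w′ ⊩ φ
⊩-bisim {k = k} (ML.prop p)    _ b s = Bisim-zero k b p .to s
⊩-bisim {k = k} (ML.negProp p) _ b s = s ∘ Bisim-zero k b p .from
⊩-bisim (φ ML.∧ ψ) d b (s , t) =
  ⊩-bisim φ (m⊔n≤o⇒m≤o _ _ d) b s , ⊩-bisim ψ (m⊔n≤o⇒n≤o (depthML φ) _ d) b t
⊩-bisim (φ ML.∨ ψ) d b (inj₁ s) = inj₁ (⊩-bisim φ (m⊔n≤o⇒m≤o _ _ d) b s)
⊩-bisim (φ ML.∨ ψ) d b (inj₂ t) = inj₂ (⊩-bisim ψ (m⊔n≤o⇒n≤o (depthML φ) _ d) b t)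
⊩-bisim (ML.◇ φ) (s≤s d) (_ , forth , _) (v , wRv , s) =
  let v′ , w′Rv′ , b = forth v wRv in v′ , w′Rv′ , ⊩-bisim φ d b s
⊩-bisim (ML.□ φ) (s≤s d) (_ , _ , back) s v′ w′Rv′ =
  let v , wRv , b = back v′ w′Rv′ in ⊩-bisim φ d b (s v wRv)

SatAt-bisim : ∀ {k} {K K′ : Kripke Φ ℓ} {w w′} φ → depthML φ ≤ k →
              Bisim k K w K′ w′ → ML.SatAt K w φ ⇔ ML.SatAt K′ w′ φ
SatAt-bisim {k = k} φ d b =
  ⇔-trans (SatAt⇔⊩ φ)
    (⇔-trans (mk⇔ (⊩-bisim φ d b) (⊩-bisim φ d (Bisim-sym k b))) (⇔-sym (SatAt⇔⊩ φ)))

maxDepth : ∀ {n} → Vec (ML.Formula Φ) n → ℕ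
maxDepth []       = 0
maxDepth (φ ∷ φs) = depthML φ ℕ.⊔ maxDepth φs

lookup-depth : ∀ {n} (φs : Vec (ML.Formula Φ) n) i → depthML (lookup φs i) ≤ maxDepth φs
lookup-depth (φ ∷ φs) Fin.zero    = m≤m⊔n _ _
lookup-depth (φ ∷ φs) (Fin.suc i) = ≤-trans (lookup-depth φs i) (m≤n⊔m (depthML φ) _)

depth : MINC.Formula Φ → ℕ
depth (MINC.prop p)      = 0
depth (MINC.negProp p)   = 0
depth (φ MINC.∧ ψ)       = depth φ ℕ.⊔ depth ψ
depth (φ MINC.∨ ψ)       = depth φ ℕ.⊔ depth ψ
depth (MINC.◇ φ)         = suc (depth φ)
depth (MINC.□ φ)         = suc (depth φ)
depth (MINC.incl φs ψs)  = maxDepth φs ℕ.⊔ maxDepth ψs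

-- Carries a witness team for `∨` or `◇` over to the other model.
bisimilarPart : ∀ k {K : Kripke Φ ℓ} (S : Team K) {K′ : Kripke Φ ℓ} → Team K′ → Team K′
bisimilarPart k {K} S {K′} T′ w′ = T′ w′ × ∃[ w ] (S w × Bisim k K w K′ w′)

bisimilarPart-TeamBisim : ∀ k {K K′ : Kripke Φ ℓ} {S T : Team K} {T′ : Team K′} →
  (∀ {w} → S w → T w) → TeamBisim k (K , T) (K′ , T′) →
  TeamBisim k (K , S) (K′ , bisimilarPart k S T′)
bisimilarPart-TeamBisim k S⊆T (forth , _) =
    (λ w w∈S → let w′ , w′∈T′ , b = forth w (S⊆T w∈S) in w′ , (w′∈T′ , w , w∈S , b) , b)
  , (λ _ → proj₂)

image-TeamBisim : ∀ k {K K′ : Kripke Φ ℓ} {T : Team K} {T′ : Team K′} →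
  TeamBisim (suc k) (K , T) (K′ , T′) → TeamBisim k (K , image K T) (K′ , image K′ T′)
image-TeamBisim k (forth , back) =
    (λ v (w , w∈T , wRv) →
       let w′ , w′∈T′ , _ , forthR , _ = forth w w∈T
           v′ , w′Rv′ , b = forthR v wRv
       in v′ , (w′ , w′∈T′ , w′Rv′) , b)
  , (λ v′ (w′ , w′∈T′ , w′Rv′) →
       let w , w∈T , _ , _ , backR = back w′ w′∈T′
           v , wRv , b = backR v′ w′Rv′
       in v , (w , w∈T , wRv) , b)

-- The slack in `depth φ ≤ k` lets both parts of a binary connective use the same `k`; each modality
-- consumes one level.
Sat-bisim : ∀ {k} {K K′ : Kripke Φ ℓ} {T T′} φ → depth φ ≤ k →
            TeamBisim k (K , T) (K′ , T′) → MINC.Sat K T φ → MINC.Sat K′ T′ φ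
Sat-bisim {k = k} (MINC.prop p) _ (_ , back) (lift T⊆V) = lift λ w′∈T′ →
  let w , w∈T , b = back _ w′∈T′ in Bisim-zero k b p .to (T⊆V w∈T)
Sat-bisim {k = k} (MINC.negProp p) _ (_ , back) (lift T∩V=∅) = lift λ w′ (w′∈T′ , w′∈V) →
  let w , w∈T , b = back w′ w′∈T′ in T∩V=∅ w (w∈T , Bisim-zero k b p .from w′∈V)
Sat-bisim (φ MINC.∧ ψ) d B (s , t) =
  Sat-bisim φ (m⊔n≤o⇒m≤o _ _ d) B s , Sat-bisim ψ (m⊔n≤o⇒n≤o (depth φ) _ d) B t
Sat-bisim {k = k} {T′ = T′} (φ MINC.∨ ψ) d B (T₁ , T₂ , (⊆T , T⊆) , s , t) =
    bisimilarPart k T₁ T′ , bisimilarPart k T₂ T′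
  , ([ proj₁ , proj₁ ]′ , cover)
  , Sat-bisim φ (m⊔n≤o⇒m≤o _ _ d) (bisimilarPart-TeamBisim k (⊆T ∘ inj₁) B) s
  , Sat-bisim ψ (m⊔n≤o⇒n≤o (depth φ) _ d) (bisimilarPart-TeamBisim k (⊆T ∘ inj₂) B) t
  where
  cover : ∀ {w′} → T′ w′ → bisimilarPart k T₁ T′ w′ ⊎ bisimilarPart k T₂ T′ w′
  cover {w′} w′∈T′ with proj₂ B w′ w′∈T′
  ... | w , w∈T , b with T⊆ w∈T
  ...   | inj₁ w∈T₁ = inj₁ (w′∈T′ , w , w∈T₁ , b)
  ...   | inj₂ w∈T₂ = inj₂ (w′∈T′ , w , w∈T₂ , b)
Sat-bisim {k = suc k} {K′ = K′} {T′ = T′} (MINC.◇ φ) (s≤s d) B@(_ , back) (S , (S⊆ , forthS) , s) =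
    -- Cutting the witness out of the image makes one half of `Step` a projection. For the other
    -- half, `w′` is matched with some `w`, whose successor in `S` is then matched with a successor
    -- of `w′`.
    bisimilarPart k S (image K′ T′)
  , ((λ _ → proj₁) , λ w′ w′∈T′ →
      let w , w∈T , _ , forthR , _ = back w′ w′∈T′
          v , v∈S , wRv = forthS w w∈T
          v′ , w′Rv′ , b = forthR v wRv
      in v′ , ((w′ , w′∈T′ , w′Rv′) , v , v∈S , b) , w′Rv′)
  , Sat-bisim φ d (bisimilarPart-TeamBisim k (S⊆ _) (image-TeamBisim k B)) s
Sat-bisim {k = suc k} (MINC.□ φ) (s≤s d) B s = Sat-bisim φ d (image-TeamBisim k B) s
Sat-bisim {k = k} (MINC.incl φs ψs) d (forth , back) s w′ w′∈T′ =
  -- Back to `T`, through the atom there, and forth to `T′`: pointwise satisfaction is preserved on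
  -- both crossings.
  let w  , w∈T   , b = back w′ w′∈T′
      v  , v∈T   , e = s w w∈T
      v′ , v′∈T′ , c = forth v v∈T
  in v′ , v′∈T′ , λ i →
    ⇔-trans (⇔-sym (SatAt-bisim (lookup φs i)
                      (≤-trans (lookup-depth φs i) (m⊔n≤o⇒m≤o _ _ d)) b))
      (⇔-trans (e i) (SatAt-bisim (lookup ψs i)
                      (≤-trans (lookup-depth ψs i) (m⊔n≤o⇒n≤o (maxDepth φs) _ d)) c))

Sat-≐ : ∀ {K : Kripke Φ ℓ} {T T′} φ → T ≐ T′ → MINC.Sat K T φ → MINC.Sat K T′ φ
Sat-≐ {K = K} φ T≐T′ = Sat-bisim φ ≤-refl (TeamBisim-≐ (depth φ) K T≐T′)

-- Unions

-- Witness teams for `∨` and `◇` are the unions of those of the members, and an inclusion atom finds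
-- its point within the same member.
Sat-⋃ : ∀ {K : Kripke Φ ℓ} φ (I : Set ℓ) (T : I → Team K) →
        (∀ i → MINC.Sat K (T i) φ) → MINC.Sat K (⋃ I T) φ
Sat-⋃ (MINC.prop p)    I T s = lift λ (i , w∈T) → s i .lower w∈T
Sat-⋃ (MINC.negProp p) I T s = lift λ w ((i , w∈T) , w∈V) → s i .lower w (w∈T , w∈V)
Sat-⋃ (φ MINC.∧ ψ) I T s = Sat-⋃ φ I T (proj₁ ∘ s) , Sat-⋃ ψ I T (proj₂ ∘ s)
Sat-⋃ {K = K} (φ MINC.∨ ψ) I T s =
    ⋃ I T₁ , ⋃ I T₂
  , ( [ (λ (i , m) → i , proj₁ (T≐ i) (inj₁ m)) , (λ (i , m) → i , proj₁ (T≐ i) (inj₂ m)) ]′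
    , (λ (i , m) → [ inj₁ ∘ (i ,_) , inj₂ ∘ (i ,_) ]′ (proj₂ (T≐ i) m)))
  , Sat-⋃ φ I T₁ (λ i → let _ , _ , _ , t , _ = s i in t)
  , Sat-⋃ ψ I T₂ (λ i → let _ , _ , _ , _ , t = s i in t)
  where
  T₁ T₂ : I → Team K
  T₁ i = proj₁ (s i)
  T₂ i = proj₁ (proj₂ (s i))
  T≐ : ∀ i → (T₁ i ∪ T₂ i) ≐ T i
  T≐ i = proj₁ (proj₂ (proj₂ (s i)))
Sat-⋃ (MINC.◇ φ) I T s =
    ⋃ I (proj₁ ∘ s)
  , ( (λ v (i , v∈S) → let _ , (back , _) , _ = s i
                           w , w∈T , wRv = back v v∈S in w , (i , w∈T) , wRv)
    , (λ w (i , w∈T) → let _ , (_ , forth) , _ = s i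
                           v , v∈S , wRv = forth w w∈T in v , (i , v∈S) , wRv))
  , Sat-⋃ φ I (proj₁ ∘ s) (λ i → proj₂ (proj₂ (s i)))
-- The image commutes with unions only up to `≐`.
Sat-⋃ {K = K} (MINC.□ φ) I T s = Sat-≐ φ
  ((λ (i , w , w∈T , wRv) → w , (i , w∈T) , wRv) , (λ (w , (i , w∈T) , wRv) → i , w , w∈T , wRv))
  (Sat-⋃ φ I (image K ∘ T) s)
Sat-⋃ (MINC.incl φs ψs) I T s w (i , w∈T) =
  let v , v∈T , e = s i w w∈T in v , (i , v∈T) , e

-- An empty team is the union of the empty family, so closure under unions applies.
Sat-empty : ∀ {K : Kripke Φ ℓ} {T} φ → (∀ w → ¬ T w) → MINC.Sat K T φ
Sat-empty {ℓ = ℓ} φ T=∅ =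
  Sat-≐ φ ((λ (i , _) → ⊥-elim (i .lower)) , (λ {w} w∈T → ⊥-elim (T=∅ w w∈T)))
    (Sat-⋃ φ (Lift ℓ ⊥) (λ _ _ → Lift ℓ ⊥) (λ i → ⊥-elim (i .lower)))

-- ML inside MINC

embed : ML.Formula Φ → MINC.Formula Φ
embed (ML.prop p)    = MINC.prop p
embed (ML.negProp p) = MINC.negProp p
embed (φ ML.∧ ψ)     = embed φ MINC.∧ embed ψ
embed (φ ML.∨ ψ)     = embed φ MINC.∨ embed ψ
embed (ML.◇ φ)       = MINC.◇ (embed φ)
embed (ML.□ φ)       = MINC.□ (embed φ)

embed⁺ : ∀ {K : Kripke Φ ℓ} {T} φ → ML.Sat K T φ → MINC.Sat K T (embed φ)
embed⁺ (ML.prop p)    s = s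
embed⁺ (ML.negProp p) s = s
embed⁺ (φ ML.∧ ψ)     (s , t) = embed⁺ φ s , embed⁺ ψ t
embed⁺ (φ ML.∨ ψ)     (T₁ , T₂ , e , s , t) = T₁ , T₂ , e , embed⁺ φ s , embed⁺ ψ t
embed⁺ (ML.◇ φ)       (S , r , s) = S , r , embed⁺ φ s
embed⁺ (ML.□ φ)       s = embed⁺ φ s

embed⁻ : ∀ {K : Kripke Φ ℓ} {T} φ → MINC.Sat K T (embed φ) → ML.Sat K T φ
embed⁻ (ML.prop p)    s = s
embed⁻ (ML.negProp p) s = s
embed⁻ (φ ML.∧ ψ)     (s , t) = embed⁻ φ s , embed⁻ ψ t
embed⁻ (φ ML.∨ ψ)     (T₁ , T₂ , e , s , t) = T₁ , T₂ , e , embed⁻ φ s , embed⁻ ψ t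
embed⁻ (ML.◇ φ)       (S , r , s) = S , r , embed⁻ φ s
embed⁻ (ML.□ φ)       s = embed⁻ φ s

embed-flat : ∀ {K : Kripke Φ ℓ} {T} φ → MINC.Sat K T (embed φ) ⇔ (∀ w → T w → K , w ⊩ φ)
embed-flat φ = mk⇔ (flat⁻ φ ∘ embed⁻ φ) (embed⁺ φ ∘ flat⁺ φ)

-- Dual formulas

-- Negation in negation normal form, as the grammar negates symbols only.
∼_ : ML.Formula Φ → ML.Formula Φ
∼ ML.prop p    = ML.negProp p
∼ ML.negProp p = ML.prop p
∼ (φ ML.∧ ψ)   = (∼ φ) ML.∨ (∼ ψ)
∼ (φ ML.∨ ψ)   = (∼ φ) ML.∧ (∼ ψ)
∼ ML.◇ φ       = ML.□ (∼ φ)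
∼ ML.□ φ       = ML.◇ (∼ φ)

∼-contradictory : ∀ {K : Kripke Φ ℓ} {w} φ → K , w ⊩ φ → ¬ (K , w ⊩ ∼ φ)
∼-contradictory (ML.prop p)    s t = t s
∼-contradictory (ML.negProp p) s t = s t
∼-contradictory (φ ML.∧ ψ) (s , _) (inj₁ t) = ∼-contradictory φ s t
∼-contradictory (φ ML.∧ ψ) (_ , s) (inj₂ t) = ∼-contradictory ψ s t
∼-contradictory (φ ML.∨ ψ) (inj₁ s) (t , _) = ∼-contradictory φ s t
∼-contradictory (φ ML.∨ ψ) (inj₂ s) (_ , t) = ∼-contradictory ψ s t
∼-contradictory (ML.◇ φ) (v , wRv , s) t = ∼-contradictory φ s (t v wRv)
∼-contradictory (ML.□ φ) s (v , wRv , t) = ∼-contradictory φ (s v wRv) t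

∼-exhaustive : ExcludedMiddle ℓ → ∀ {K : Kripke Φ ℓ} {w} φ → (K , w ⊩ φ) ⊎ (K , w ⊩ ∼ φ)
∼-exhaustive em {K} {w} (ML.prop p) with em {V K p w}
... | yes s = inj₁ s
... | no ¬s = inj₂ ¬s
∼-exhaustive em {K} {w} (ML.negProp p) with em {V K p w}
... | yes s = inj₂ s
... | no ¬s = inj₁ ¬s
∼-exhaustive em (φ ML.∧ ψ) with ∼-exhaustive em φ | ∼-exhaustive em ψ
... | inj₁ s | inj₁ t = inj₁ (s , t)
... | inj₂ s | _      = inj₂ (inj₁ s)
... | _      | inj₂ t = inj₂ (inj₂ t)
∼-exhaustive em (φ ML.∨ ψ) with ∼-exhaustive em φ | ∼-exhaustive em ψ
... | inj₂ s | inj₂ t = inj₂ (s , t)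
... | inj₁ s | _      = inj₁ (inj₁ s)
... | _      | inj₁ t = inj₁ (inj₂ t)
∼-exhaustive em {K} {w} (ML.◇ φ) with em {K , w ⊩ ML.◇ φ}
... | yes s = inj₁ s
... | no ¬s = inj₂ λ v wRv →
  [ (λ s → contradiction (v , wRv , s) ¬s) , id ]′ (∼-exhaustive em φ)
-- The existential side is decided: its refutation yields `φ` at every successor, while a refuted
-- `□ φ` would not directly yield a successor.
∼-exhaustive em {K} {w} (ML.□ φ) with em {K , w ⊩ ML.◇ (∼ φ)}
... | yes s = inj₂ s
... | no ¬s = inj₁ λ v wRv →
  [ id , (λ s → contradiction (v , wRv , s) ¬s) ]′ (∼-exhaustive em φ)

-- Conjunctions that choose one formula from each of finitely many pairs

module Choice {a b f} {X : Set a} {F : Set f} (_⊨_ : X → F → Set b)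
  (⊤′ : F) (_∧′_ : F → F → F)
  (⊨-⊤ : ∀ x → x ⊨ ⊤′)
  (⊨-∧ : ∀ {x φ ψ} → (x ⊨ (φ ∧′ ψ)) ⇔ ((x ⊨ φ) × (x ⊨ ψ)))
  where

  -- Instantiated twice: with points and ML-formulas for the Hintikka formulas, and with teams and
  -- MINC-formulas for the descriptions.
  choices : List (F × F) → List F
  choices []               = ⊤′ ∷ []
  choices ((φ , ψ) ∷ pairs) = cartesianProductWith _∧′_ (φ ∷ ψ ∷ []) (choices pairs)

  choices-exhaustive : ∀ {x} pairs → (∀ {φ ψ} → (φ , ψ) ∈ pairs → (x ⊨ φ) ⊎ (x ⊨ ψ)) →
                       ∃[ θ ] (θ ∈ choices pairs × x ⊨ θ)
  choices-exhaustive []                _ = ⊤′ , here refl , ⊨-⊤ _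
  choices-exhaustive ((φ , ψ) ∷ pairs) h
    with choices-exhaustive pairs (h ∘ there) | h (here refl)
  ... | θ , θ∈ , t | inj₁ s =
    (φ ∧′ θ) , ∈-cartesianProductWith⁺ _∧′_ {xs = φ ∷ ψ ∷ []} (here refl) θ∈ , ⊨-∧ .from (s , t)
  ... | θ , θ∈ , t | inj₂ s =
    (ψ ∧′ θ) , ∈-cartesianProductWith⁺ _∧′_ {xs = φ ∷ ψ ∷ []} (there (here refl)) θ∈ , ⊨-∧ .from (s , t)

  -- `θ` has a fixed member of each pair as a conjunct, which therefore holds of everything
  -- satisfying `θ`.
  choices-agree : ∀ {x y θ} pairs → θ ∈ choices pairs → x ⊨ θ → y ⊨ θ →
                  ∀ {φ ψ} → (φ , ψ) ∈ pairs → ((x ⊨ φ) × (y ⊨ φ)) ⊎ ((x ⊨ ψ) × (y ⊨ ψ))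
  choices-agree (pair@(φ , ψ) ∷ pairs) θ∈ s t m
    with ∈-cartesianProductWith⁻ _∧′_ (φ ∷ ψ ∷ []) (choices pairs) θ∈
  ... | χ , θ′ , χ∈ , θ′∈ , refl with m | χ∈
  ...   | here refl | here refl         = inj₁ (proj₁ (⊨-∧ .to s) , proj₁ (⊨-∧ .to t))
  ...   | here refl | there (here refl) = inj₂ (proj₁ (⊨-∧ .to s) , proj₁ (⊨-∧ .to t))
  ...   | there m′  | _ = choices-agree pairs θ′∈ (proj₂ (⊨-∧ .to s)) (proj₂ (⊨-∧ .to t)) m′

module Finite (em : ExcludedMiddle ℓ) {Φ : Set} (p₀ : Φ)
  (props : List Φ) (∈-props : ∀ p → p ∈ props) where

  -- The grammar has no constant for truth; building one takes a symbol, which is where nonemptiness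
  -- of `Φ` enters.
  ⊤ML : ML.Formula Φ
  ⊤ML = ML.prop p₀ ML.∨ (∼ ML.prop p₀)

  ⊩-⊤ML : ∀ (K : Kripke Φ ℓ) w → K , w ⊩ ⊤ML
  ⊩-⊤ML K w = ∼-exhaustive em {K} (ML.prop p₀)

  SatAt-⊤ML : ∀ (K : Kripke Φ ℓ) w → ML.SatAt K w ⊤ML
  SatAt-⊤ML K w = SatAt⇔⊩ {K = K} ⊤ML .from (⊩-⊤ML K w)

  -- Hintikka formulas

  private
    module Points = Choice {X = Σ[ K ∈ Kripke Φ ℓ ] W K} (λ (K , w) φ → K , w ⊩ φ)
      ⊤ML ML._∧_ (uncurry ⊩-⊤ML) (mk⇔ id id)

  withDual : ML.Formula Φ → ML.Formula Φ × ML.Formula Φ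
  withDual φ = φ , ∼ φ

  -- A Hintikka formula settles every symbol and which formulas of the previous depth hold at some
  -- successor. Each rejected `◇ χ` contributes `□ (∼ χ)`, in place of the customary box over a
  -- disjunction.
  basis : ℕ → List (ML.Formula Φ)
  hintikka : ℕ → List (ML.Formula Φ)
  basis zero    = List.map ML.prop props
  basis (suc k) = List.map ML.prop props ++ List.map ML.◇ (hintikka k)
  hintikka k = Points.choices (List.map withDual (basis k))

  hintikka-exhaustive : ∀ k (K : Kripke Φ ℓ) w → ∃[ χ ] (χ ∈ hintikka k × (K , w ⊩ χ))
  hintikka-exhaustive k K w = Points.choices-exhaustive (List.map withDual (basis k)) decide
    where
    decide : ∀ {φ ψ} → (φ , ψ) ∈ List.map withDual (basis k) → (K , w ⊩ φ) ⊎ (K , w ⊩ ψ)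
    decide m with ∈-map⁻ withDual m
    ... | φ , _ , refl = ∼-exhaustive em φ

  -- `χ` settles `φ` the same way at both points, and truth of `φ` at `w` rules out `∼ φ`.
  basis-transfer : ∀ k {χ} → χ ∈ hintikka k → ∀ {K K′ : Kripke Φ ℓ} {w w′} →
    K , w ⊩ χ → K′ , w′ ⊩ χ → ∀ {φ} → φ ∈ basis k → K , w ⊩ φ → K′ , w′ ⊩ φ
  basis-transfer k χ∈ s s′ {φ} φ∈ t
    with Points.choices-agree (List.map withDual (basis k)) χ∈ s s′ (∈-map⁺ withDual φ∈)
  ... | inj₁ (_ , t′) = t′
  ... | inj₂ (t∼ , _) = contradiction t∼ (∼-contradictory φ t)

  prop∈basis : ∀ k p → ML.prop p ∈ basis k
  prop∈basis zero    p = ∈-map⁺ ML.prop (∈-props p)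
  prop∈basis (suc k) p = ∈-++⁺ˡ (∈-map⁺ ML.prop (∈-props p))

  ◇∈basis : ∀ k {χ} → χ ∈ hintikka k → ML.◇ χ ∈ basis (suc k)
  ◇∈basis k χ∈ = ∈-++⁺ʳ (List.map ML.prop props) (∈-map⁺ ML.◇ χ∈)

  hintikka-Bisim : ∀ k {χ} → χ ∈ hintikka k → ∀ {K K′ : Kripke Φ ℓ} {w w′} →
    K , w ⊩ χ → K′ , w′ ⊩ χ → Bisim k K w K′ w′
  hintikka-Bisim zero χ∈ s s′ p =
    mk⇔ (basis-transfer zero χ∈ s s′ (prop∈basis zero p))
        (basis-transfer zero χ∈ s′ s (prop∈basis zero p))
  hintikka-Bisim (suc k) χ∈ {K} {K′} s s′ =
      (λ p → mk⇔ (basis-transfer (suc k) χ∈ s s′ (prop∈basis (suc k) p))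
                 (basis-transfer (suc k) χ∈ s′ s (prop∈basis (suc k) p)))
    , (λ v wRv →
         -- The type of `v` is named by some `χ′`; transferring `◇ χ′` gives a successor of `w′` of
         -- the same type.
         let χ′ , χ′∈ , t = hintikka-exhaustive k K v
             v′ , w′Rv′ , t′ = basis-transfer (suc k) χ∈ s s′ (◇∈basis k χ′∈) (v , wRv , t)
         in v′ , w′Rv′ , hintikka-Bisim k χ′∈ t t′)
    , (λ v′ w′Rv′ →
         let χ′ , χ′∈ , t′ = hintikka-exhaustive k K′ v′
             v , wRv , t = basis-transfer (suc k) χ∈ s′ s (◇∈basis k χ′∈) (v′ , w′Rv′ , t′)
         in v , wRv , hintikka-Bisim k χ′∈ t t′)

  -- Descriptions of nonempty teams

  present : ML.Formula Φ → MINC.Formula Φ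
  present χ = MINC.incl (⊤ML ∷ []) (χ ∷ [])

  present⁺ : ∀ {K : Kripke Φ ℓ} {T} χ → ∃[ v ] (T v × (K , v ⊩ χ)) → MINC.Sat K T (present χ)
  present⁺ {K} χ (v , v∈T , s) w _ =
    v , v∈T , λ { Fin.zero → mk⇔ (λ _ → SatAt⇔⊩ χ .from s) (λ _ → SatAt-⊤ML K w) }

  present⁻ : ∀ {K : Kripke Φ ℓ} {T w} χ → T w → MINC.Sat K T (present χ) →
             ∃[ v ] (T v × (K , v ⊩ χ))
  present⁻ {K} {w = w} χ w∈T s =
    let v , v∈T , e = s w w∈T
    in v , v∈T , SatAt⇔⊩ χ .to (e Fin.zero .to (SatAt-⊤ML K w))

  Sat-⊤ML : ∀ (K : Kripke Φ ℓ) T → MINC.Sat K T (embed ⊤ML)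
  Sat-⊤ML K T = embed-flat {K = K} ⊤ML .from (λ w _ → ⊩-⊤ML K w)

  private
    module Teams = Choice {X = KT Φ ℓ} (λ (K , T) φ → MINC.Sat K T φ)
      (embed ⊤ML) MINC._∧_ (uncurry Sat-⊤ML) (mk⇔ id id)

  -- The two alternatives exclude each other on nonempty teams only; the empty team satisfies both.
  presentOrAbsent : ML.Formula Φ → MINC.Formula Φ × MINC.Formula Φ
  presentOrAbsent χ = present χ , embed (∼ χ)

  descriptions : ℕ → List (MINC.Formula Φ)
  descriptions k = Teams.choices (List.map presentOrAbsent (hintikka k))

  descriptions-exhaustive : ∀ k (K : Kripke Φ ℓ) T → ∃[ θ ] (θ ∈ descriptions k × MINC.Sat K T θ)
  descriptions-exhaustive k K T =
    Teams.choices-exhaustive (List.map presentOrAbsent (hintikka k)) decide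
    where
    decide : ∀ {φ ψ} → (φ , ψ) ∈ List.map presentOrAbsent (hintikka k) →
             MINC.Sat K T φ ⊎ MINC.Sat K T ψ
    decide m with ∈-map⁻ presentOrAbsent m
    ... | χ , _ , refl with em {∃[ v ] (T v × (K , v ⊩ χ))}
    ...   | yes e = inj₁ (present⁺ χ e)
    ...   | no ¬e = inj₂ (embed-flat (∼ χ) .from λ v v∈T →
      [ (λ s → contradiction (v , v∈T , s) ¬e) , id ]′ (∼-exhaustive em χ))

  -- The Hintikka formula `χ` of `w` cannot be declared absent by `θ`, so it is declared present,
  -- and the point `w′` turns this into an actual point of `T′` satisfying `χ`.
  present-transfer : ∀ k {θ} → θ ∈ descriptions k → ∀ {K K′ : Kripke Φ ℓ} {T T′ w′} → T′ w′ →
    MINC.Sat K T θ → MINC.Sat K′ T′ θ →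
    ∀ w → T w → ∃[ v′ ] (T′ v′ × Bisim k K w K′ v′)
  present-transfer k θ∈ {K} w′∈T′ s s′ w w∈T with hintikka-exhaustive k K w
  ... | χ , χ∈ , t
    with Teams.choices-agree (List.map presentOrAbsent (hintikka k)) θ∈ s s′
           (∈-map⁺ presentOrAbsent χ∈)
  ...   | inj₁ (_ , u′) = let v′ , v′∈T′ , t′ = present⁻ χ w′∈T′ u′
                          in v′ , v′∈T′ , hintikka-Bisim k χ∈ t t′
  ...   | inj₂ (u , _)  = contradiction (embed-flat (∼ χ) .to u w w∈T) (∼-contradictory χ t)

  descriptions-TeamBisim : ∀ k {θ} → θ ∈ descriptions k →
    ∀ {K K′ : Kripke Φ ℓ} {T T′ w w′} → T w → T′ w′ →
    MINC.Sat K T θ → MINC.Sat K′ T′ θ → TeamBisim k (K , T) (K′ , T′)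
  descriptions-TeamBisim k θ∈ w∈T w′∈T′ s s′ =
      present-transfer k θ∈ w′∈T′ s s′
    , (λ v v∈T′ → Product.map₂ (Product.map₂ (Bisim-sym k))
                    (present-transfer k θ∈ w∈T s′ s v v∈T′))

  -- Finite disjunctions

  -- The base formula holds exactly of the empty team, the closest to falsity that a logic with the
  -- empty team property allows.
  ⋁ : List (MINC.Formula Φ) → MINC.Formula Φ
  ⋁ = foldr MINC._∨_ (MINC.prop p₀ MINC.∧ MINC.negProp p₀)

  -- All other disjuncts receive the empty team.
  ⋁⁺ : ∀ {K : Kripke Φ ℓ} {T θ θs} → θ ∈ θs → MINC.Sat K T θ → MINC.Sat K T (⋁ θs)
  ⋁⁺ {T = T} {θs = _ ∷ θs} (here refl) s =
    T , ∅ , ([ id , (λ ()) ]′ , inj₁) , s , Sat-empty (⋁ θs) (λ _ ())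
  ⋁⁺ {T = T} {θs = φ ∷ _} (there θ∈) s =
    ∅ , T , ([ (λ ()) , id ]′ , inj₂) , Sat-empty φ (λ _ ()) , ⋁⁺ θ∈ s

  -- Definability of classes with the closure properties

  module _ {𝒦 : Pred (KT Φ ℓ) κ} (em′ : ExcludedMiddle (lsuc ℓ ⊔ κ))
    (unions : ClosedUnderUnions 𝒦) (k : ℕ) (bisim : ClosedUnderTeamBisim k 𝒦)
    (empty : EmptyTeamProperty 𝒦) where

    𝒦-≐ : ∀ {K : Kripke Φ ℓ} {T T′ : Team K} → T ≐ T′ → 𝒦 (K , T) → 𝒦 (K , T′)
    𝒦-≐ {K} T≐T′ m = bisim _ _ m (TeamBisim-≐ k K T≐T′)

    𝒦-empty : ∀ {K : Kripke Φ ℓ} {T : Team K} → (∀ w → ¬ T w) → 𝒦 (K , T)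
    𝒦-empty {K} T=∅ = 𝒦-≐ ((λ ()) , λ {w} w∈T → ⊥-elim (T=∅ w w∈T)) (empty K)

    𝒦-∪ : ∀ {K : Kripke Φ ℓ} {T₁ T₂ : Team K} → 𝒦 (K , T₁) → 𝒦 (K , T₂) → 𝒦 (K , T₁ ∪ T₂)
    𝒦-∪ {K} {T₁} {T₂} m₁ m₂ = 𝒦-≐
      ( (λ { (lift true , w∈T) → inj₁ w∈T ; (lift false , w∈T) → inj₂ w∈T })
      , [ lift true ,_ , lift false ,_ ]′)
      (unions K (Lift ℓ Bool) (λ i → if i .lower then T₁ else T₂)
        λ { (lift true) → m₁ ; (lift false) → m₂ })

    -- A nonempty team is demanded because the empty team is in `𝒦` and satisfies every formula, so
    -- it would realise all descriptions.
    Realised : MINC.Formula Φ → Set (lsuc ℓ ⊔ κ)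
    Realised θ = Σ[ (K , T) ∈ KT Φ ℓ ] (𝒦 (K , T) × (∃[ w ] T w) × MINC.Sat K T θ)

    realised : List (MINC.Formula Φ)
    realised = filter (λ θ → em′ {Realised θ}) (descriptions k)

    Realised-sound : ∀ {θ} → θ ∈ descriptions k → Realised θ →
                     ∀ {K : Kripke Φ ℓ} {T} → MINC.Sat K T θ → 𝒦 (K , T)
    Realised-sound θ∈ (_ , m , (w , w∈T) , s) {T = T′} s′ with em {∃[ w ] T′ w}
    ... | yes (w′ , w′∈T′) = bisim _ _ m (descriptions-TeamBisim k θ∈ w∈T w′∈T′ s s′)
    ... | no T′=∅          = 𝒦-empty (λ w′ w′∈T′ → T′=∅ (w′ , w′∈T′))

    ⋁-sound : ∀ θs → (∀ {θ} → θ ∈ θs → ∀ {K : Kripke Φ ℓ} {T} → MINC.Sat K T θ → 𝒦 (K , T)) →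
              ∀ {K : Kripke Φ ℓ} {T} → MINC.Sat K T (⋁ θs) → 𝒦 (K , T)
    ⋁-sound []       h (lift T⊆V , lift T∩V=∅) = 𝒦-empty (λ w w∈T → T∩V=∅ w (w∈T , T⊆V w∈T))
    ⋁-sound (θ ∷ θs) h (T₁ , T₂ , T≐ , s , t) =
      𝒦-≐ T≐ (𝒦-∪ (h (here refl) s) (⋁-sound θs (h ∘ there) t))

    -- A nonempty member of `𝒦` realises its own description, which is thus among the disjuncts.
    ⋁-complete : ∀ {K : Kripke Φ ℓ} {T} → 𝒦 (K , T) → MINC.Sat K T (⋁ realised)
    ⋁-complete {K} {T} m with em {∃[ w ] T w}
    ... | no T=∅ = Sat-empty (⋁ realised) (λ w w∈T → T=∅ (w , w∈T))
    ... | yes ne = let θ , θ∈ , s = descriptions-exhaustive k K T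
                   in ⋁⁺ (∈-filter⁺ (λ θ → em′ {Realised θ}) θ∈ ((K , T) , m , ne , s)) s

    definable : DefinableInMINC 𝒦
    definable = ⋁ realised , ⋁-complete , ⋁-sound realised λ θ∈ →
      let θ∈k , r = ∈-filter⁻ (λ θ → em′ {Realised θ}) θ∈ in Realised-sound θ∈k r

-- Lets the one assumption, made at the level of `Realised`, also decide statements about points at
-- level ℓ.
lower-em : ∀ b → ExcludedMiddle (a ⊔ b) → ExcludedMiddle a
lower-em b em {P} = map′ lower lift (em {Lift b P})

theorem3p10 : ∀ {ℓ κ : Level} → ExcludedMiddle (lsuc ℓ ⊔ κ) → ∀ {n : ℕ} (Φ : Set) → Φ ↔ Fin (suc n) → (𝒦 : Pred (KT Φ ℓ) κ) →
    DefinableInMINC 𝒦 ⇔ (ClosedUnderUnions 𝒦 × (∃[ k ] ClosedUnderTeamBisim k 𝒦) × EmptyTeamProperty 𝒦)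
theorem3p10 {ℓ} {κ} em {n} Φ Φ↔Fin 𝒦 = mk⇔
  (λ (φ , 𝒦⊆ , ⊆𝒦) →
      (λ K I T m → ⊆𝒦 (Sat-⋃ φ I T (λ i → 𝒦⊆ (m i))))
    -- The modal depth of the defining formula serves as `k`.
    , (depth φ , λ _ _ m B → ⊆𝒦 (Sat-bisim φ ≤-refl B (𝒦⊆ m)))
    , (λ K → ⊆𝒦 (Sat-empty φ (λ _ ()))))
  (λ (unions , (k , bisim) , empty) → definable em unions k bisim empty)
  where
  module Φ = Inverse Φ↔Fin
  ∈-props : ∀ p → p ∈ List.map Φ.from (allFin (suc n))
  ∈-props p = subst (_∈ _) (Φ.strictlyInverseʳ p) (∈-map⁺ Φ.from (∈-allFin (Φ.to p)))
  open Finite (lower-em (lsuc ℓ ⊔ κ) em) (Φ.from Fin.zero) _ ∈-props
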